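{- Let $k\in\mathbb{Z}$, let $n\ge 0$ be an integer, and let $\lambda\in\mathbb{C}$ be nonzero. Then $$\beta_{n,\lambda}^{(-k)}=\sum_{m=0}^{n}\sum_{j=0}^{m}(-1)^{j+m}\,j!\,\lambda^{n-m}(j+1)^{k}S_{2}(m,j)S_{1}(n,m).$$
   Context: For $r\in\mathbb{Z}$, $\mathrm{Li}_r(u)=\sum_{n=1}^{\infty}\frac{u^n}{n^r}$. For nonzero $\lambda$ and $r\in\mathbb{Z}$, the fully degenerate poly-Bernoulli numbers $\beta_{n,\lambda}^{(r)}$ of index $r$ are defined by the generating function (identity of formal power series in $t$) $$\frac{\mathrm{Li}_{r}\left(1-(1+\lambda t)^{ -1/\lambda}\right)}{1-(1+\lambda t)^{ -1/\lambda}}=\sum_{n=0}^{\infty}\beta_{n,\lambda}^{(r)}\frac{t^{n}}{n!},$$ where $(1+\lambda t)^{a}=\sum_{j\ge0}(a)_j\lambda^j\frac{t^j}{j!}$, $(a)_j=a(a-1)\cdots(a-j+1)$ with $(a)_0=1$, and $\mathrm{Li}_r(u)/u$ denotes the series $\sum_{m\ge 0}u^m/(m+1)^r$. $S_1(n,l)$ denotes the (signed) Stirling numbers of the first kind, $(x)_n=\sum_{l=0}^n S_1(n,l)x^l$, and $S_2(n,l)$ the Stirling numbers of the second kind, $\frac{(e^t-1)^l}{l!}=\sum_{n\ge l}S_2(n,l)\frac{t^n}{n!}$. -}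

module Defs where

open import Algebra.Apartness.Bundles using (HeytingCommutativeRing; HeytingField)
open import Algebra.Bundles using (CommutativeRing; Semiring)
open import Algebra.Bundles.Raw using (RawRing)
import Algebra.Apartness.Properties.HeytingCommutativeRing as HeytingProperties
import Algebra.Definitions.RawSemiring as RawSemiringDefs
open import Data.Fin.Base using (toℕ)
open import Data.Integer.Base using (ℤ; +_; -[1+_])
open import Data.Nat.Base as ℕ using (ℕ; zero; suc; _∸_; _!)
open import Data.Nat.Properties using (_!≢0)
open import Data.Product.Base using (∃-syntax; _,_; proj₁; proj₂)
open import Function.Base using (_∘_)
open import Level using (Level; _⊔_)
import Relation.Binary.Reasoning.Setoid as ≈-Reasoning

private variable
  c ℓ₁ ℓ₂ : Level

module Falling (R : RawRing c ℓ₁) where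
  open RawRing R
  open RawSemiringDefs rawSemiring using (_×_)

  -- x (x - 1) ⋯ (x - n + 1)
  falling : Carrier → ℕ → Carrier
  falling x zero    = 1#
  falling x (suc n) = falling x n * (x + (- (n × 1#)))

-- Formal power series, given by their coefficient sequences.
module PowerSeries (R : CommutativeRing c ℓ₁) where
  open CommutativeRing R
  open RawSemiringDefs (Semiring.rawSemiring semiring) using (sum)

  sum≤ : ℕ → (ℕ → Carrier) → Carrier
  sum≤ n f = sum {suc n} (f ∘ toℕ)

  infixr 5 sum≤
  syntax sum≤ n (λ i → x) = ∑[ i ≤ n ] x

  Series : Set c
  Series = ℕ → Carrier

  const : Carrier → Series
  const a zero    = a
  const a (suc _) = 0#

  X : Series
  X zero          = 0#
  X (suc zero)    = 1#
  X (suc (suc _)) = 0#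

  seriesRawRing : RawRing c ℓ₁
  seriesRawRing = record
    { Carrier = Series
    ; _≈_     = λ f g → ∀ n → f n ≈ g n
    ; _+_     = λ f g n → f n + g n
    ; _*_     = λ f g n → ∑[ i ≤ n ] (f i * g (n ∸ i))
    ; -_      = λ f n → - (f n)
    ; 0#      = const 0#
    ; 1#      = const 1#
    }

  module S where
    open RawRing seriesRawRing public
    open RawSemiringDefs rawSemiring public using (_^_)

  -- F(u).  As u has no constant term, u ^ m only contributes to the
  -- coefficients of index at least m, so the sum below is complete.
  compose : Series → (u : Series) → u 0 ≈ 0# → Series
  compose F u _ n = ∑[ m ≤ n ] (F m * (u S.^ m) n)

CharacteristicZero : HeytingField c ℓ₁ ℓ₂ → Set ℓ₂
CharacteristicZero K = ∀ n → .{{ℕ.NonZero n}} → (n × 1#) # 0#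
  where
  open HeytingCommutativeRing (HeytingField.heytingCommutativeRing K)
  open CommutativeRing commutativeRing using (semiring)
  open RawSemiringDefs (Semiring.rawSemiring semiring) using (_×_)

-- The complex numbers are an instance: classically with _≉_ as the apartness,
-- constructively with "at positive distance".
module DegeneratePolyBernoulli
  (K : HeytingField c ℓ₁ ℓ₂) (char0 : CharacteristicZero K) where

  open HeytingField K public
    using (Carrier; _≈_; _#_; _+_; _*_; -_; 0#; 1#)
  open HeytingField K using (heytingCommutativeRing; #⇒invertible)
  open HeytingCommutativeRing heytingCommutativeRing using (commutativeRing)
  open CommutativeRing commutativeRing
    using ( semiring; setoid; *-congˡ; *-congʳ; *-assoc; *-comm; *-identityˡ
          ; *-identityʳ; +-congˡ; +-identityʳ; -‿cong; -‿inverseʳ; sym; trans)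
  open HeytingProperties heytingCommutativeRing
    using (1#0; x#0y#0→xy#0; invertibleʳ⇒#; x-0≈x)
  open RawSemiringDefs (Semiring.rawSemiring semiring) using (_×_)
  open RawSemiringDefs (Semiring.rawSemiring semiring) public using (_^_)
  open PowerSeries commutativeRing public

  fromℕ : ℕ → Carrier
  fromℕ n = n × 1#

  Nonzero : Set (c ⊔ ℓ₂)
  Nonzero = ∃[ x ] x # 0#

  value : Nonzero → Carrier
  value = proj₁

  nonzero : ∀ n → .{{ℕ.NonZero n}} → Nonzero
  nonzero n = fromℕ n , char0 n

  factorial : ℕ → Nonzero
  factorial n = nonzero (n !) {{n !≢0}}

  1/_ : Nonzero → Carrier
  1/ (x , x#0) = proj₁ (#⇒invertible x#0)

  infix 8 1/_

  x*1/x≈1 : ∀ x → value x * 1/ x ≈ 1#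
  x*1/x≈1 (x , x#0) =
    trans (*-congʳ (sym (x-0≈x x))) (proj₂ (proj₂ (#⇒invertible x#0)))

  _⁻¹ : Nonzero → Nonzero
  x ⁻¹ = 1/ x , invertibleʳ⇒# (value x , (begin
    (1/ x + (- 0#)) * value x  ≈⟨ *-congʳ (x-0≈x _) ⟩
    1/ x * value x             ≈⟨ *-comm _ _ ⟩
    value x * 1/ x             ≈⟨ x*1/x≈1 x ⟩
    1#                         ∎))
    where open ≈-Reasoning setoid

  _^⁺_ : Nonzero → ℕ → Nonzero
  (x , x#0) ^⁺ n = x ^ n , power n
    where
    power : ∀ n → x ^ n # 0#
    power zero    = 1#0
    power (suc n) = x#0y#0→xy#0 x#0 (power n)

  _^ᶻ_ : Nonzero → ℤ → Nonzero
  x ^ᶻ (+ n)    = x ^⁺ n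
  x ^ᶻ -[1+ n ] = (x ⁻¹) ^⁺ suc n

  infix 8 _⁻¹
  infixr 8 _^⁺_ _^ᶻ_

  -- The series ∑ aₙ tⁿ / n!.
  egf : (ℕ → Carrier) → Series
  egf a n = a n * 1/ factorial n

  -- The sequence a with ∑ aₙ tⁿ / n! = F.
  egfCoefficients : Series → ℕ → Carrier
  egfCoefficients F n = fromℕ (n !) * F n

  egf-egfCoefficients : ∀ F → egf (egfCoefficients F) S.≈ F
  egf-egfCoefficients F n = begin
    fromℕ (n !) * F n * 1/ factorial n    ≈⟨ *-congʳ (*-comm _ _) ⟩
    F n * fromℕ (n !) * 1/ factorial n    ≈⟨ *-assoc _ _ _ ⟩
    F n * (fromℕ (n !) * 1/ factorial n)  ≈⟨ *-congˡ (x*1/x≈1 (factorial n)) ⟩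
    F n * 1#                              ≈⟨ *-identityʳ _ ⟩
    F n                                   ∎
    where open ≈-Reasoning setoid

  -- Signed; the coefficient of x^l in the polynomial (x)ₙ.
  S₁ : ℕ → ℕ → Carrier
  S₁ n l = falling X n l
    where open Falling seriesRawRing

  exp : Series
  exp = egf (λ _ → 1#)

  -- The index n varies along ∑ₙ S₂(n,l) tⁿ / n! = (eᵗ - 1)^l / l!.
  S₂ : ℕ → ℕ → Carrier
  S₂ n l = egfCoefficients (λ i → ((exp S.+ S.- S.1#) S.^ l) i * 1/ factorial l) n

  -- (1 + x t)^a
  binomialSeries : Carrier → Carrier → Series
  binomialSeries x a = egf (λ j → falling a j * x ^ j)
    where open Falling (CommutativeRing.rawRing commutativeRing)

  -- Liᵣ(u)/u = ∑ uᵐ / (m + 1)ʳ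
  Li/u : ℤ → Series
  Li/u r m = 1/ (nonzero (suc m) ^ᶻ r)

  -- 1 - (1 + ƛ t)^(-1/ƛ)
  argument : Nonzero → Series
  argument ƛ = S.1# S.+ S.- binomialSeries (value ƛ) (- (1/ ƛ))

  argument-0 : ∀ ƛ → argument ƛ 0 ≈ 0#
  argument-0 ƛ = begin
    1# + (- (1# * 1# * 1/ factorial 0))      ≈⟨ +-congˡ (-‿cong (*-congʳ lemma)) ⟩
    1# + (- (fromℕ 1 * 1/ factorial 0))      ≈⟨ +-congˡ (-‿cong (x*1/x≈1 (factorial 0))) ⟩
    1# + (- 1#)                              ≈⟨ -‿inverseʳ 1# ⟩
    0#                                       ∎
    where
    open ≈-Reasoning setoid
    lemma : 1# * 1# ≈ fromℕ 1
    lemma = trans (*-identityʳ 1#) (sym (+-identityʳ 1#))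

  polyBernoulliSeries : ℤ → Nonzero → Series
  polyBernoulliSeries r ƛ = compose (Li/u r) (argument ƛ) (argument-0 ƛ)

  -- The fully degenerate poly-Bernoulli number of index r; by
  -- egf-egfCoefficients its exponential generating function is the series above.
  β : ℕ → Nonzero → ℤ → Carrier
  β n ƛ r = egfCoefficients (polyBernoulliSeries r ƛ) n

{-# OPTIONS --safe #-}
module Submission where

open import Defs
open import Algebra.Apartness.Bundles using (HeytingField; HeytingCommutativeRing)
open import Algebra.Bundles using (CommutativeRing)
open import Algebra.Bundles.Raw using (RawRing)
import Algebra.Definitions.RawSemiring as RawSemiringDefs
import Algebra.Properties.CommutativeSemiring.Exp as ExpProperties
import Algebra.Properties.Ring as RingProperties
import Algebra.Properties.Semiring.Mult as MultProperties
import Algebra.Properties.Semiring.Sum as SumProperties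
import Algebra.Solver.Ring.NaturalCoefficients.Default as SemiringSolver
open import Data.Fin.Base using (toℕ)
open import Data.Integer.Base as ℤ using (ℤ)
open import Data.Nat.Base as ℕ using (ℕ; zero; suc; _∸_; _!; _≤_; _<_; z≤n; s≤s)
import Data.Nat.Properties as ℕₚ
open import Data.Sum.Base using (inj₁; inj₂)
open import Level using (_⊔_)
import Relation.Binary.PropositionalEquality as ≡
import Relation.Binary.Reasoning.Setoid as ≈-Reasoning
open import Relation.Nullary using (yes; no)

-- The substitution t ↦ -log(1 + ƛ t)/ƛ turns eᵗ - 1 into (1 + ƛ t)^(-1/ƛ) - 1,
-- and on exponential generating functions it acts by the matrix
-- (-1)^m ƛ^(n-m) S₁(n,m).  Only the span of the exponentials e^(a t) is needed:
-- e^(a t) and its image (1 + ƛ t)^(-a/ƛ) are pinned down by first order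
-- recurrences, which give the matrix action on them directly, and the span
-- contains the powers of eᵗ - 1.  The j-th power of the argument of Liᵣ is thus
-- the image of (-1)^j (eᵗ - 1)^j = ∑ (-1)^j j! S₂(m,j) tᵐ / m!.

module SeriesProperties {c ℓ} (R : CommutativeRing c ℓ) where
  open CommutativeRing R
  open RingProperties ring
    using (-‿distribˡ-*; -1*x≈-x; -‿+-comm; -0#≈0#; -‿involutive)
  open MultProperties semiring using (_×_; ×-homo-+; ×-homo-1; ×-congˡ; ×1-homo-*)
  open ExpProperties commutativeSemiring using (_^_; ^-congˡ; ^-distrib-*)
  open SumProperties semiring
    using (sum-replicate-zero; ∑-distrib-+; ∑-comm; *-distribˡ-sum)
  open SemiringSolver commutativeSemiring
  open PowerSeries R
  open ≈-Reasoning setoid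

  -- Natural multiples of one and finite sums

  fromℕ : ℕ → Carrier
  fromℕ n = n × 1#

  sum≤-cong : ∀ n f g → (∀ i → i ≤ n → f i ≈ g i) → sum≤ n f ≈ sum≤ n g
  sum≤-cong zero    f g f≈g = +-congʳ (f≈g 0 z≤n)
  sum≤-cong (suc n) f g f≈g =
    +-cong (f≈g 0 z≤n) (sum≤-cong n (λ i → f (suc i)) (λ i → g (suc i)) (λ i i≤n → f≈g (suc i) (s≤s i≤n)))

  sum≤-zero : ∀ n f → (∀ i → i ≤ n → f i ≈ 0#) → sum≤ n f ≈ 0#
  sum≤-zero n f f≈0 = trans (sum≤-cong n f (λ _ → 0#) f≈0) (sum-replicate-zero (suc n))

  sum≤-+ : ∀ n f g → ∑[ i ≤ n ] (f i + g i) ≈ sum≤ n f + sum≤ n g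
  sum≤-+ n f g = ∑-distrib-+ {suc n} (λ i → f (toℕ i)) (λ i → g (toℕ i))

  *-sum≤ : ∀ n x f → x * sum≤ n f ≈ ∑[ i ≤ n ] (x * f i)
  *-sum≤ n x f = *-distribˡ-sum {suc n} x (λ i → f (toℕ i))

  sum≤-comm : ∀ m n (f : ℕ → ℕ → Carrier) →
    ∑[ i ≤ m ] ∑[ j ≤ n ] f i j ≈ ∑[ j ≤ n ] ∑[ i ≤ m ] f i j
  sum≤-comm m n f = ∑-comm {suc m} {suc n} (λ i j → f (toℕ i) (toℕ j))

  sum≤-suc : ∀ n f → sum≤ (suc n) f ≈ sum≤ n f + f (suc n)
  sum≤-suc zero    f = solve 2 (λ x y → x :+ (y :+ con 0) := (x :+ con 0) :+ y) refl (f 0) (f 1)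
  sum≤-suc (suc n) f = begin
    f 0 + sum≤ (suc n) (λ i → f (suc i))            ≈⟨ +-congˡ (sum≤-suc n (λ i → f (suc i))) ⟩
    f 0 + (sum≤ n (λ i → f (suc i)) + f (suc (suc n)))  ≈⟨ +-assoc _ _ _ ⟨
    f 0 + sum≤ n (λ i → f (suc i)) + f (suc (suc n))  ∎

  sum≤-extend : ∀ {m n} f → m ≤ n → (∀ i → m < i → f i ≈ 0#) → sum≤ m f ≈ sum≤ n f
  sum≤-extend {m} {zero}  f z≤n _ = refl
  sum≤-extend {m} {suc n} f m≤n f≈0 with ℕₚ.m≤n⇒m<n∨m≡n m≤n
  ... | inj₂ ≡.refl    = refl
  ... | inj₁ (s≤s m≤n) = begin
    sum≤ m f               ≈⟨ sum≤-extend f m≤n f≈0 ⟩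
    sum≤ n f               ≈⟨ +-identityʳ _ ⟨
    sum≤ n f + 0#          ≈⟨ +-congˡ (f≈0 (suc n) (s≤s m≤n)) ⟨
    sum≤ n f + f (suc n)   ≈⟨ sum≤-suc n f ⟨
    sum≤ (suc n) f         ∎

  -- Cauchy products of power series

  term : Series → Series → ℕ → ℕ → Carrier
  term F G n i = F i * G (n ∸ i)

  infixr 8 _•_
  _•_ : Carrier → Series → Series
  (x • F) n = x * F n

  tail : Series → Series
  tail F n = F (suc n)

  *-congˡ-S : ∀ F {G H} → G S.≈ H → F S.* G S.≈ F S.* H
  *-congˡ-S F {G} {H} G≈H n =
    sum≤-cong n (term F G n) (term F H n) (λ i _ → *-congˡ (G≈H (n ∸ i)))

  *-congʳ-S : ∀ F {G H} → G S.≈ H → G S.* F S.≈ H S.* F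
  *-congʳ-S F {G} {H} G≈H n =
    sum≤-cong n (term G F n) (term H F n) (λ i _ → *-congʳ (G≈H i))

  *-distribˡ-S : ∀ F G H → F S.* (G S.+ H) S.≈ (F S.* G) S.+ (F S.* H)
  *-distribˡ-S F G H n = trans
    (sum≤-cong n (term F (G S.+ H) n) (λ i → term F G n i + term F H n i) (λ i _ → distribˡ _ _ _))
    (sum≤-+ n (term F G n) (term F H n))

  *-distribʳ-S : ∀ F G H → (G S.+ H) S.* F S.≈ (G S.* F) S.+ (H S.* F)
  *-distribʳ-S F G H n = trans
    (sum≤-cong n (term (G S.+ H) F n) (λ i → term G F n i + term H F n i) (λ i _ → distribʳ _ _ _))
    (sum≤-+ n (term G F n) (term H F n))

  •-*ˡ : ∀ x F G → (x • F) S.* G S.≈ x • (F S.* G)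
  •-*ˡ x F G n = sym (trans (*-sum≤ n x (term F G n))
    (sum≤-cong n (λ i → x * term F G n i) (term (x • F) G n) (λ i _ → sym (*-assoc _ _ _))))

  •-*ʳ : ∀ x F G → F S.* (x • G) S.≈ x • (F S.* G)
  •-*ʳ x F G n = sym (trans (*-sum≤ n x (term F G n))
    (sum≤-cong n (λ i → x * term F G n i) (term F (x • G) n) (λ i _ →
      solve 3 (λ x y z → x :* (y :* z) := y :* (x :* z)) refl x (F i) (G (n ∸ i)))))

  -‿•-S : ∀ F → S.- F S.≈ (- 1#) • F
  -‿•-S F n = sym (-1*x≈-x (F n))

  -- Peeling off the first summand, which puts a tail on the left factor, holds by computation.
  -- Peeling off the last one is the counterpart for the right factor; there `suc n ∸ i` exposes a
  -- successor only because i ≤ n.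
  *-tail : ∀ F G n → (F S.* G) (suc n) ≈ (F S.* tail G) n + F (suc n) * G 0
  *-tail F G n = begin
    (F S.* G) (suc n)
      ≈⟨ sum≤-suc n (term F G (suc n)) ⟩
    sum≤ n (λ i → F i * G (suc n ∸ i)) + F (suc n) * G (n ∸ n)
      ≈⟨ +-cong
           (sum≤-cong n (term F G (suc n)) (term F (tail G) n)
             (λ i i≤n → *-congˡ (reflexive (≡.cong G (ℕₚ.+-∸-assoc 1 i≤n)))))
           (*-congˡ (reflexive (≡.cong G (ℕₚ.n∸n≡0 n)))) ⟩
    (F S.* tail G) n + F (suc n) * G 0 ∎

  *-constant : ∀ F {G} → (∀ n → tail G n ≈ 0#) → ∀ n → (F S.* G) n ≈ F n * G 0
  *-constant F _       zero    = +-identityʳ _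
  *-constant F {G} tailG≈0 (suc n) = begin
    (F S.* G) (suc n)
      ≈⟨ *-tail F G n ⟩
    (F S.* tail G) n + F (suc n) * G 0
      ≈⟨ +-congʳ (sum≤-zero n (term F (tail G) n) (λ i _ → trans (*-congˡ (tailG≈0 (n ∸ i))) (zeroʳ _))) ⟩
    0# + F (suc n) * G 0
      ≈⟨ +-identityˡ _ ⟩
    F (suc n) * G 0 ∎

  *-identityˡ-S : ∀ F → S.1# S.* F S.≈ F
  *-identityˡ-S F zero    = trans (+-identityʳ _) (*-identityˡ _)
  *-identityˡ-S F (suc n) =
    trans (+-cong (*-identityˡ _) (sum≤-zero n (term (tail S.1#) F n) (λ i _ → zeroˡ _))) (+-identityʳ _)

  -- Each factor raises the order by at least one: `F 0` kills the only summand that uses `F S.^ j`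
  -- at the full index, and the others use it at indices at most n < j.
  ^-vanishes-below : ∀ F → F 0 ≈ 0# → ∀ j {n} → n < j → (F S.^ j) n ≈ 0#
  ^-vanishes-below F F₀≈0 (suc j) {zero} _ =
    trans (+-identityʳ _) (trans (*-congʳ F₀≈0) (zeroˡ _))
  ^-vanishes-below F F₀≈0 (suc j) {suc n} (s≤s n<j) = begin
    F 0 * (F S.^ j) (suc n) + (tail F S.* (F S.^ j)) n
      ≈⟨ +-cong
           (trans (*-congʳ F₀≈0) (zeroˡ _))
           (sum≤-zero n (term (tail F) (F S.^ j) n) (λ i _ → trans
             (*-congˡ (^-vanishes-below F F₀≈0 j (ℕₚ.≤-<-trans (ℕₚ.m∸n≤m n i) n<j)))
             (zeroʳ _))) ⟩
    0# + 0#
      ≈⟨ +-identityʳ _ ⟩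
    0# ∎

  -- The Euler operator and first order recurrences

  -- The operator t d/dt. Unlike d/dt it keeps the index, so its product rule only splits the weight
  -- n as i + (n - i).
  θ : Series → Series
  θ F n = fromℕ n * F n

  θ-* : ∀ F G → θ (F S.* G) S.≈ (θ F S.* G) S.+ (F S.* θ G)
  θ-* F G n = begin
    fromℕ n * (F S.* G) n
      ≈⟨ *-sum≤ n _ (term F G n) ⟩
    ∑[ i ≤ n ] (fromℕ n * (F i * G (n ∸ i)))
      ≈⟨ sum≤-cong n (λ i → fromℕ n * term F G n i) (λ i → term (θ F) G n i + term F (θ G) n i)
           (λ i i≤n → trans (*-congʳ (split i≤n))
           (solve 4 (λ x y z w → (x :+ y) :* (z :* w) := x :* z :* w :+ z :* (y :* w)) refl
             (fromℕ i) (fromℕ (n ∸ i)) (F i) (G (n ∸ i)))) ⟩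
    ∑[ i ≤ n ] (θ F i * G (n ∸ i) + F i * θ G (n ∸ i))
      ≈⟨ sum≤-+ n (term (θ F) G n) (term F (θ G) n) ⟩
    (θ F S.* G) n + (F S.* θ G) n ∎
    where
    split : ∀ {i} → i ≤ n → fromℕ n ≈ fromℕ i + fromℕ (n ∸ i)
    split {i} i≤n = trans (×-congˡ (≡.sym (ℕₚ.m+[n∸m]≡n i≤n))) (×-homo-+ 1# i (n ∸ i))

  -- Coefficient form of (1 + h t) F′ = a F with F(0) = 1, which characterises
  -- F = (1 + h t)^(a/h), and F = e^(a t) when h = 0.
  record IsBinomialSeries (h a : Carrier) (F : Series) : Set ℓ where
    field
      head : F 0 ≈ 1#
      step : ∀ n → θ F (suc n) ≈ (a + - (fromℕ n * h)) * F n

  open IsBinomialSeries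

  binomial-1 : ∀ h → IsBinomialSeries h 0# S.1#
  binomial-1 h .head = refl
  binomial-1 h .step zero    = begin
    fromℕ 1 * 0#                      ≈⟨ zeroʳ _ ⟩
    0#                                ≈⟨ -0#≈0# ⟨
    - 0#                              ≈⟨ -‿cong (zeroˡ h) ⟨
    - (0# * h)                        ≈⟨ +-identityˡ _ ⟨
    0# + - (0# * h)                   ≈⟨ *-identityʳ _ ⟨
    (0# + - (0# * h)) * 1#            ∎
  binomial-1 h .step (suc n) = trans (zeroʳ _) (sym (zeroʳ _))

  -- By the product rule for `θ`: since n h = i h + (n - i) h, every summand of the Cauchy product
  -- acquires the same factor a + b - n h, which then leaves the sum.
  binomial-* : ∀ {h a b F G} → IsBinomialSeries h a F → IsBinomialSeries h b G →
    IsBinomialSeries h (a + b) (F S.* G)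
  binomial-* f g .head =
    trans (+-identityʳ _) (trans (*-cong (f .head) (g .head)) (*-identityʳ 1#))
  binomial-* {h} {a} {b} {F} {G} f g .step n = begin
    θ (F S.* G) (suc n)
      ≈⟨ θ-* F G (suc n) ⟩
    (0# * F 0) * G (suc n) + (tail (θ F) S.* G) n + (F S.* θ G) (suc n)
      -- `θ F` and `θ G` have constant term 0, so one product loses its first summand and the other
      -- its last; both become sums over i ≤ n.
      ≈⟨ +-cong
           (trans (+-congʳ (trans (*-congʳ (zeroˡ _)) (zeroˡ _))) (+-identityˡ _))
           (trans (*-tail F (θ G) n)
             (trans (+-congˡ (trans (*-congˡ (zeroˡ _)) (zeroʳ _))) (+-identityʳ _))) ⟩
    (tail (θ F) S.* G) n + (F S.* tail (θ G)) n
      ≈⟨ sum≤-+ n (term (tail (θ F)) G n) (term F (tail (θ G)) n) ⟨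
    ∑[ i ≤ n ] (θ F (suc i) * G (n ∸ i) + F i * θ G (suc (n ∸ i)))
      ≈⟨ sum≤-cong n
           (λ i → term (tail (θ F)) G n i + term F (tail (θ G)) n i)
           (λ i → (a + b + - (fromℕ n * h)) * term F G n i)
           (λ i i≤n → summand i≤n) ⟩
    ∑[ i ≤ n ] ((a + b + - (fromℕ n * h)) * (F i * G (n ∸ i)))
      ≈⟨ *-sum≤ n _ (term F G n) ⟨
    (a + b + - (fromℕ n * h)) * (F S.* G) n ∎
    where
    split : ∀ {i} → i ≤ n → - (fromℕ n * h) ≈ - (fromℕ i * h) + - (fromℕ (n ∸ i) * h)
    split {i} i≤n = begin
      - (fromℕ n * h)                               ≈⟨ -‿cong (*-congʳ (×-congˡ (≡.sym (ℕₚ.m+[n∸m]≡n i≤n)))) ⟩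
      - (fromℕ (i ℕ.+ (n ∸ i)) * h)                 ≈⟨ -‿cong (*-congʳ (×-homo-+ 1# i (n ∸ i))) ⟩
      - ((fromℕ i + fromℕ (n ∸ i)) * h)             ≈⟨ -‿cong (distribʳ _ _ _) ⟩
      - (fromℕ i * h + fromℕ (n ∸ i) * h)           ≈⟨ -‿+-comm _ _ ⟨
      - (fromℕ i * h) + - (fromℕ (n ∸ i) * h)       ∎
    summand : ∀ {i} → i ≤ n →
      θ F (suc i) * G (n ∸ i) + F i * θ G (suc (n ∸ i)) ≈
      (a + b + - (fromℕ n * h)) * (F i * G (n ∸ i))
    summand {i} i≤n = begin
      θ F (suc i) * G (n ∸ i) + F i * θ G (suc (n ∸ i))
        ≈⟨ +-cong (*-congʳ (f .step i)) (*-congˡ (g .step (n ∸ i))) ⟩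
      (a + - (fromℕ i * h)) * F i * G (n ∸ i) + F i * ((b + - (fromℕ (n ∸ i) * h)) * G (n ∸ i))
        ≈⟨ solve 6 (λ a b x y z w →
             (a :+ x) :* z :* w :+ z :* ((b :+ y) :* w) := (a :+ b :+ (x :+ y)) :* (z :* w)) refl
             a b (- (fromℕ i * h)) (- (fromℕ (n ∸ i) * h)) (F i) (G (n ∸ i)) ⟩
      (a + b + (- (fromℕ i * h) + - (fromℕ (n ∸ i) * h))) * (F i * G (n ∸ i))
        ≈⟨ *-congʳ (+-congˡ (split i≤n)) ⟨
      (a + b + - (fromℕ n * h)) * (F i * G (n ∸ i)) ∎

  binomial-cong : ∀ {h a b F} → a ≈ b → IsBinomialSeries h a F → IsBinomialSeries h b F
  binomial-cong a≈b f .head   = f .head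
  binomial-cong a≈b f .step n = trans (f .step n) (*-congʳ (+-congʳ a≈b))

  -- Signs and Stirling numbers of the first kind

  -1^_ : ℕ → Carrier
  -1^ n = (- 1#) ^ n

  private
    module SP = RawSemiringDefs (RawRing.rawSemiring seriesRawRing)

  open Falling seriesRawRing using () renaming (falling to fallingS)

  -- The falling factorial (x)ₙ as a series in x; `S₁ n` unfolds to the same term.
  stirling₁ : ℕ → Series
  stirling₁ n = fallingS X n

  ×1-S-0 : ∀ n → (n SP.× S.1#) 0 ≈ fromℕ n
  ×1-S-0 zero    = refl
  ×1-S-0 (suc n) = +-congˡ (×1-S-0 n)

  ×1-S-suc : ∀ n i → (n SP.× S.1#) (suc i) ≈ 0#
  ×1-S-suc zero    i = refl
  ×1-S-suc (suc n) i = trans (+-identityˡ _) (×1-S-suc n i)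

  private
    x≈0⇒-x≈0 : ∀ {x} → x ≈ 0# → - x ≈ 0#
    x≈0⇒-x≈0 x≈0 = trans (-‿cong x≈0) -0#≈0#

    factor : ℕ → Series
    factor n = X S.+ S.- (n SP.× S.1#)

    factor-0 : ∀ n → factor n 0 ≈ - fromℕ n
    factor-0 n = trans (+-identityˡ _) (-‿cong (×1-S-0 n))

    factor-1 : ∀ n → factor n 1 ≈ 1#
    factor-1 n = trans (+-congˡ (x≈0⇒-x≈0 (×1-S-suc n 0))) (+-identityʳ _)

    factor-2+ : ∀ n i → factor n (suc (suc i)) ≈ 0#
    factor-2+ n i = trans (+-identityˡ _) (x≈0⇒-x≈0 (×1-S-suc n (suc i)))

  stirling₁-suc-0 : ∀ n → stirling₁ (suc n) 0 ≈ - fromℕ n * stirling₁ n 0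
  stirling₁-suc-0 n = begin
    stirling₁ n 0 * factor n 0 + 0#   ≈⟨ +-identityʳ _ ⟩
    stirling₁ n 0 * factor n 0        ≈⟨ *-congˡ (factor-0 n) ⟩
    stirling₁ n 0 * - fromℕ n         ≈⟨ *-comm _ _ ⟩
    - fromℕ n * stirling₁ n 0         ∎

  -- Multiplication by the linear polynomial x - n, whose coefficients are - n, 1, 0, 0, and so on.
  stirling₁-suc-suc : ∀ n m →
    stirling₁ (suc n) (suc m) ≈ stirling₁ n m + - fromℕ n * stirling₁ n (suc m)
  stirling₁-suc-suc n m = begin
    stirling₁ (suc n) (suc m)
      ≈⟨ *-tail (stirling₁ n) (factor n) m ⟩
    (stirling₁ n S.* tail (factor n)) m + stirling₁ n (suc m) * factor n 0
      ≈⟨ +-cong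
           (trans (*-constant (stirling₁ n) {tail (factor n)} (factor-2+ n) m)
             (trans (*-congˡ (factor-1 n)) (*-identityʳ _)))
           (trans (*-congˡ (factor-0 n)) (*-comm _ _)) ⟩
    stirling₁ n m + - fromℕ n * stirling₁ n (suc m) ∎

  stirling₁-vanishes-above : ∀ n {m} → n < m → stirling₁ n m ≈ 0#
  stirling₁-vanishes-above zero    (s≤s _)   = refl
  stirling₁-vanishes-above (suc n) {suc m} (s≤s n<m) = begin
    stirling₁ (suc n) (suc m)
      ≈⟨ stirling₁-suc-suc n m ⟩
    stirling₁ n m + - fromℕ n * stirling₁ n (suc m)
      ≈⟨ +-cong (stirling₁-vanishes-above n n<m)
           (trans (*-congˡ (stirling₁-vanishes-above n (ℕₚ.m<n⇒m<1+n n<m))) (zeroʳ _)) ⟩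
    0# + 0#
      ≈⟨ +-identityʳ _ ⟩
    0# ∎

  -- The coefficient of a^m in a (a - h) ⋯ (a - (n - 1) h).
  degenerateStirling₁ : Carrier → ℕ → ℕ → Carrier
  degenerateStirling₁ h n m = stirling₁ n m * h ^ (n ∸ m)

  degenerateStirling₁-suc-0 : ∀ h n →
    degenerateStirling₁ h (suc n) 0 ≈ - (fromℕ n * h) * degenerateStirling₁ h n 0
  degenerateStirling₁-suc-0 h n = begin
    stirling₁ (suc n) 0 * (h * h ^ n)
      ≈⟨ *-congʳ (stirling₁-suc-0 n) ⟩
    - fromℕ n * stirling₁ n 0 * (h * h ^ n)
      ≈⟨ solve 4 (λ x y z w → x :* y :* (z :* w) := (x :* z) :* (y :* w)) refl
           (- fromℕ n) (stirling₁ n 0) h (h ^ n) ⟩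
    (- fromℕ n * h) * (stirling₁ n 0 * h ^ n)
      ≈⟨ *-congʳ (-‿distribˡ-* _ _) ⟨
    - (fromℕ n * h) * (stirling₁ n 0 * h ^ n) ∎

  degenerateStirling₁-suc-suc : ∀ h n m →
    degenerateStirling₁ h (suc n) (suc m) ≈
    degenerateStirling₁ h n m + - (fromℕ n * h) * degenerateStirling₁ h n (suc m)
  degenerateStirling₁-suc-suc h n m = begin
    stirling₁ (suc n) (suc m) * h ^ (n ∸ m)
      ≈⟨ *-congʳ (stirling₁-suc-suc n m) ⟩
    (stirling₁ n m + - fromℕ n * stirling₁ n (suc m)) * h ^ (n ∸ m)
      ≈⟨ solve 4 (λ x y z w → (x :+ y :* z) :* w := x :* w :+ y :* (z :* w)) refl
           (stirling₁ n m) (- fromℕ n) (stirling₁ n (suc m)) (h ^ (n ∸ m)) ⟩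
    degenerateStirling₁ h n m + - fromℕ n * (stirling₁ n (suc m) * h ^ (n ∸ m))
      ≈⟨ +-congˡ (*-congˡ lower) ⟩
    degenerateStirling₁ h n m + - fromℕ n * (h * degenerateStirling₁ h n (suc m))
      ≈⟨ +-congˡ (trans (sym (*-assoc _ _ _)) (*-congʳ (sym (-‿distribˡ-* _ _)))) ⟩
    degenerateStirling₁ h n m + - (fromℕ n * h) * degenerateStirling₁ h n (suc m) ∎
    where
    lower : stirling₁ n (suc m) * h ^ (n ∸ m) ≈ h * degenerateStirling₁ h n (suc m)
    lower with m ℕₚ.<? n
    ... | yes m<n = begin
      stirling₁ n (suc m) * h ^ (n ∸ m)
        ≈⟨ *-congˡ (reflexive (≡.cong (h ^_) (ℕₚ.+-∸-assoc 1 m<n))) ⟩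
      stirling₁ n (suc m) * (h * h ^ (n ∸ suc m))
        ≈⟨ solve 3 (λ x y z → x :* (y :* z) := y :* (x :* z)) refl _ _ _ ⟩
      h * degenerateStirling₁ h n (suc m) ∎
    -- For n ≤ m both exponents are truncated to 0 and no factor h can be split off; the equation
    -- survives because the Stirling number is 0.
    ... | no m≮n = begin
      stirling₁ n (suc m) * h ^ (n ∸ m)     ≈⟨ trans (*-congʳ vanishes) (zeroˡ _) ⟩
      0#                                    ≈⟨ trans (*-congˡ (trans (*-congʳ vanishes) (zeroˡ _))) (zeroʳ _) ⟨
      h * degenerateStirling₁ h n (suc m)   ∎
      where
      vanishes : stirling₁ n (suc m) ≈ 0#
      vanishes = stirling₁-vanishes-above n (s≤s (ℕₚ.≮⇒≥ m≮n))

  -- Coefficients of exponentials and binomial series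

  -- Turns a recurrence for `θ F` into one for the sequence n! Fₙ.
  factorial-step : ∀ F n → fromℕ (suc n !) * F (suc n) ≈ fromℕ (n !) * θ F (suc n)
  factorial-step F n = trans (*-congʳ (×1-homo-* (suc n) (n !)))
    (solve 3 (λ x y z → x :* y :* z := y :* (x :* z)) refl _ _ _)

  exponential-coefficients : ∀ {a F} → IsBinomialSeries 0# a F →
    ∀ n → fromℕ (n !) * F n ≈ a ^ n
  exponential-coefficients f zero    =
    trans (*-cong (×-homo-1 1#) (f .head)) (*-identityʳ 1#)
  exponential-coefficients {a} {F} f (suc n) = begin
    fromℕ (suc n !) * F (suc n)
      ≈⟨ factorial-step F n ⟩
    fromℕ (n !) * θ F (suc n)
      ≈⟨ *-congˡ (f .step n) ⟩
    fromℕ (n !) * ((a + - (fromℕ n * 0#)) * F n)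
      ≈⟨ *-congˡ (*-congʳ (trans (+-congˡ (x≈0⇒-x≈0 (zeroʳ _))) (+-identityʳ _))) ⟩
    fromℕ (n !) * (a * F n)
      ≈⟨ solve 3 (λ x y z → x :* (y :* z) := y :* (x :* z)) refl _ _ _ ⟩
    a * (fromℕ (n !) * F n)
      ≈⟨ *-congˡ (exponential-coefficients f n) ⟩
    a * a ^ n ∎

  -- Here n! Fₙ is a (a - h) ⋯ (a - (n - 1) h), and the right side is its expansion in powers of a.
  -- In the induction, the recurrence of `degenerateStirling₁` accounts for the new factor a - n h.
  binomial-coefficients : ∀ {h a F} → IsBinomialSeries h a F →
    ∀ n → fromℕ (n !) * F n ≈ ∑[ m ≤ n ] (degenerateStirling₁ h n m * a ^ m)
  binomial-coefficients {h} f zero = begin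
    fromℕ 1 * _                  ≈⟨ *-cong (×-homo-1 1#) (f .head) ⟩
    1# * 1#                      ≈⟨ solve 0 (con 1 :* con 1 := con 1 :* con 1 :* con 1 :+ con 0) refl ⟩
    1# * 1# * 1# + 0#            ∎
  binomial-coefficients {h} {a} {F} f (suc n) = begin
    fromℕ (suc n !) * F (suc n)
      ≈⟨ factorial-step F n ⟩
    fromℕ (n !) * θ F (suc n)
      ≈⟨ *-congˡ (f .step n) ⟩
    fromℕ (n !) * ((a + N) * F n)
      ≈⟨ solve 3 (λ x y z → x :* (y :* z) := y :* (x :* z)) refl _ _ _ ⟩
    (a + N) * (fromℕ (n !) * F n)
      ≈⟨ *-congˡ (binomial-coefficients f n) ⟩
    (a + N) * sum≤ n t
      ≈⟨ distribʳ _ _ _ ⟩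
    a * sum≤ n t + N * sum≤ n t
      -- A zero summand at m = n + 1 is appended to the second sum, so that after its summand at 0
      -- is removed the rest is again indexed by i ≤ n and lines up with the first sum.
      ≈⟨ +-congˡ (*-congˡ (sum≤-extend t (ℕₚ.n≤1+n n) (λ i n<i →
           trans (*-congʳ (trans (*-congʳ (stirling₁-vanishes-above n n<i)) (zeroˡ _))) (zeroˡ _)))) ⟩
    a * sum≤ n t + N * (t 0 + sum≤ n (tail t))
      ≈⟨ solve 4 (λ x y z w → x :+ y :* (z :+ w) := y :* z :+ (x :+ y :* w)) refl
           (a * sum≤ n t) N (t 0) (sum≤ n (tail t)) ⟩
    N * t 0 + (a * sum≤ n t + N * sum≤ n (tail t))
      ≈⟨ +-congˡ (+-cong (*-sum≤ n a t) (*-sum≤ n N (tail t))) ⟩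
    N * t 0 + (sum≤ n (λ i → a * t i) + sum≤ n (λ i → N * t (suc i)))
      ≈⟨ +-congˡ (sum≤-+ n (λ i → a * t i) (λ i → N * t (suc i))) ⟨
    N * t 0 + sum≤ n (λ i → a * t i + N * t (suc i))
      ≈⟨ +-cong
           (trans (sym (*-assoc _ _ _)) (*-congʳ (sym (degenerateStirling₁-suc-0 h n))))
           (sum≤-cong n (λ i → a * t i + N * t (suc i)) (tail t′) (λ i _ → summand i)) ⟩
    sum≤ (suc n) t′ ∎
    where
    N = - (fromℕ n * h)
    t t′ : ℕ → Carrier
    t  m = degenerateStirling₁ h n m * a ^ m
    t′ m = degenerateStirling₁ h (suc n) m * a ^ m
    summand : ∀ i → a * t i + N * t (suc i) ≈ t′ (suc i)
    summand i = begin
      a * t i + N * t (suc i)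
        ≈⟨ solve 5 (λ a p x y z → a :* (x :* p) :+ y :* (z :* (a :* p)) := (x :+ y :* z) :* (a :* p)) refl
             a (a ^ i) (degenerateStirling₁ h n i) N (degenerateStirling₁ h n (suc i)) ⟩
      (degenerateStirling₁ h n i + N * degenerateStirling₁ h n (suc i)) * a ^ suc i
        ≈⟨ *-congʳ (degenerateStirling₁-suc-suc h n i) ⟨
      t′ (suc i) ∎

  -- The logarithmic substitution on the span of exponentials

  -- The graph of the substitution t ↦ -log(1 + h t)/h on the span of the
  -- exponentials e^(a t), which it sends to (1 + h t)^(-a/h).
  data Substitution (h : Carrier) : Series → Series → Set (c ⊔ ℓ) where
    exponential : ∀ {a F G} → IsBinomialSeries 0# a F → IsBinomialSeries h (- a) G →
                  Substitution h F G
    add         : ∀ {F F′ G G′} → Substitution h F G → Substitution h F′ G′ →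
                  Substitution h (F S.+ F′) (G S.+ G′)
    scale       : ∀ x {F G} → Substitution h F G → Substitution h (x • F) (x • G)
    respect     : ∀ {F F′ G G′} → F S.≈ F′ → G S.≈ G′ → Substitution h F G →
                  Substitution h F′ G′

  -- Exponents add on both sides, which settles the exponentials; multiplication by a fixed series
  -- is linear, which settles the rest of the span.
  substitution-* : ∀ {h a E B F G} →
    IsBinomialSeries 0# a E → IsBinomialSeries h (- a) B →
    Substitution h F G → Substitution h (E S.* F) (B S.* G)
  substitution-* e b (exponential f g) =
    exponential (binomial-* e f) (binomial-cong (-‿+-comm _ _) (binomial-* b g))
  substitution-* {E = E} {B} e b (add {F} {F′} {G} {G′} s s′) = respect
    (λ n → sym (*-distribˡ-S E F F′ n)) (λ n → sym (*-distribˡ-S B G G′ n))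
    (add (substitution-* e b s) (substitution-* e b s′))
  substitution-* {E = E} {B} e b (scale x {F} {G} s) = respect
    (λ n → sym (•-*ʳ x E F n)) (λ n → sym (•-*ʳ x B G n))
    (scale x (substitution-* e b s))
  substitution-* {E = E} {B} e b (respect F≈F′ G≈G′ s) = respect
    (*-congˡ-S E F≈F′) (*-congˡ-S B G≈G′) (substitution-* e b s)

  -- With Q the previous power, (1 - B) Q = Q - B Q stays in the span by `substitution-*`. The sign
  -- turns (1 - eᵗ)^j into the power of eᵗ - 1 that defines `S₂`.
  substitution-^ : ∀ {h E B} →
    IsBinomialSeries 0# 1# E → IsBinomialSeries h (- 1#) B →
    ∀ j → Substitution h ((-1^ j) • ((E S.+ S.- S.1#) S.^ j)) ((S.1# S.+ S.- B) S.^ j)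
  substitution-^ {h} e b zero = respect (λ n → sym (*-identityˡ _)) (λ _ → refl)
    -- The series 1 is the exponential with a = 0, and its own image.
    (exponential (binomial-1 0#) (binomial-cong (sym -0#≈0#) (binomial-1 h)))
  substitution-^ {h} {E} {B} e b (suc j) = respect left right
    (add s (scale (- 1#) (substitution-* e b s)))
    where
    s = substitution-^ e b j
    P Q : Series
    P = (E S.+ S.- S.1#) S.^ j
    Q = (S.1# S.+ S.- B) S.^ j
    left : (((-1^ j) • P) S.+ ((- 1#) • (E S.* ((-1^ j) • P)))) S.≈
           ((-1^ suc j) • ((E S.+ S.- S.1#) S.* P))
    left n = begin
      -1^ j * P n + - 1# * (E S.* ((-1^ j) • P)) n
        -- A factor (-1)(-1) is inserted so that (-1)^(j+1) can be taken out of both summands.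
        ≈⟨ +-cong (trans (sym (*-identityˡ _)) (*-congʳ (sym -1*-1≈1))) (*-congˡ (•-*ʳ (-1^ j) E P n)) ⟩
      - 1# * - 1# * (-1^ j * P n) + - 1# * (-1^ j * (E S.* P) n)
        ≈⟨ solve 4 (λ m s p q → m :* m :* (s :* p) :+ m :* (s :* q) := m :* s :* (q :+ m :* p)) refl
             (- 1#) (-1^ j) (P n) ((E S.* P) n) ⟩
      -1^ suc j * ((E S.* P) n + - 1# * P n)
        ≈⟨ *-congˡ (+-congˡ (*-congˡ (*-identityˡ-S P n))) ⟨
      -1^ suc j * ((E S.* P) n + - 1# * (S.1# S.* P) n)
        ≈⟨ *-congˡ (+-congˡ (•-*ˡ (- 1#) S.1# P n)) ⟨
      -1^ suc j * ((E S.* P) n + (((- 1#) • S.1#) S.* P) n)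
        ≈⟨ *-congˡ (+-congˡ (*-congʳ-S P (-‿•-S S.1#) n)) ⟨
      -1^ suc j * ((E S.* P) n + ((S.- S.1#) S.* P) n)
        ≈⟨ *-congˡ (*-distribʳ-S P E (S.- S.1#) n) ⟨
      -1^ suc j * ((E S.+ S.- S.1#) S.* P) n ∎
      where
      -1*-1≈1 : - 1# * - 1# ≈ 1#
      -1*-1≈1 = trans (-1*x≈-x _) (-‿involutive 1#)
    right : (Q S.+ ((- 1#) • (B S.* Q))) S.≈ ((S.1# S.+ S.- B) S.* Q)
    right n = begin
      Q n + - 1# * (B S.* Q) n
        ≈⟨ +-cong (*-identityˡ-S Q n) (•-*ˡ (- 1#) B Q n) ⟨
      (S.1# S.* Q) n + (((- 1#) • B) S.* Q) n
        ≈⟨ +-congˡ (*-congʳ-S Q (-‿•-S B) n) ⟨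
      (S.1# S.* Q) n + ((S.- B) S.* Q) n
        ≈⟨ *-distribʳ-S Q S.1# (S.- B) n ⟨
      ((S.1# S.+ S.- B) S.* Q) n ∎

  -- Both sides are linear in the pair (F, G), so exponentials decide: there m! Fₘ = a^m, and (-
  -- a)^m = (-1)^m a^m supplies the sign.
  substitution-coefficients : ∀ {h F G} → Substitution h F G → ∀ n →
    fromℕ (n !) * G n ≈
    ∑[ m ≤ n ] (degenerateStirling₁ h n m * -1^ m * (fromℕ (m !) * F m))
  substitution-coefficients {h} (exponential {a} {F} {G} f g) n = begin
    fromℕ (n !) * G n
      ≈⟨ binomial-coefficients g n ⟩
    ∑[ m ≤ n ] (d m * (- a) ^ m)
      ≈⟨ sum≤-cong n (λ m → d m * (- a) ^ m) (λ m → d m * -1^ m * (fromℕ (m !) * F m))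
           (λ m _ → begin
             d m * (- a) ^ m                       ≈⟨ *-congˡ (^-congˡ m (-1*x≈-x a)) ⟨
             d m * (- 1# * a) ^ m                  ≈⟨ *-congˡ (^-distrib-* (- 1#) a m) ⟩
             d m * (-1^ m * a ^ m)                 ≈⟨ *-assoc _ _ _ ⟨
             d m * -1^ m * a ^ m                   ≈⟨ *-congˡ (exponential-coefficients f m) ⟨
             d m * -1^ m * (fromℕ (m !) * F m)     ∎) ⟩
    ∑[ m ≤ n ] (d m * -1^ m * (fromℕ (m !) * F m)) ∎
    where
    d : ℕ → Carrier
    d = degenerateStirling₁ h n
  substitution-coefficients {h} (add {F} {F′} {G} {G′} s s′) n = begin
    fromℕ (n !) * (G n + G′ n)
      ≈⟨ distribˡ _ _ _ ⟩
    fromℕ (n !) * G n + fromℕ (n !) * G′ n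
      ≈⟨ +-cong (substitution-coefficients s n) (substitution-coefficients s′ n) ⟩
    sum≤ n (t F) + sum≤ n (t F′)
      ≈⟨ sum≤-+ n (t F) (t F′) ⟨
    sum≤ n (λ m → t F m + t F′ m)
      ≈⟨ sum≤-cong n (λ m → t F m + t F′ m) (t (F S.+ F′)) (λ m _ →
           solve 4 (λ d x y z → d :* (x :* y) :+ d :* (x :* z) := d :* (x :* (y :+ z))) refl
             (degenerateStirling₁ h n m * -1^ m) (fromℕ (m !)) (F m) (F′ m)) ⟩
    sum≤ n (t (F S.+ F′)) ∎
    where
    t : Series → ℕ → Carrier
    t F m = degenerateStirling₁ h n m * -1^ m * (fromℕ (m !) * F m)
  substitution-coefficients {h} (scale x {F} {G} s) n = begin
    fromℕ (n !) * (x * G n)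
      ≈⟨ solve 3 (λ x y z → x :* (y :* z) := y :* (x :* z)) refl (fromℕ (n !)) x (G n) ⟩
    x * (fromℕ (n !) * G n)
      ≈⟨ *-congˡ (substitution-coefficients s n) ⟩
    x * sum≤ n (t F)
      ≈⟨ *-sum≤ n x (t F) ⟩
    sum≤ n (λ m → x * t F m)
      ≈⟨ sum≤-cong n (λ m → x * t F m) (t (x • F)) (λ m _ →
           solve 4 (λ x d y z → x :* (d :* (y :* z)) := d :* (y :* (x :* z))) refl
             x (degenerateStirling₁ h n m * -1^ m) (fromℕ (m !)) (F m)) ⟩
    sum≤ n (t (x • F)) ∎
    where
    t : Series → ℕ → Carrier
    t F m = degenerateStirling₁ h n m * -1^ m * (fromℕ (m !) * F m)
  substitution-coefficients {h} (respect {F} {F′} {G} {G′} F≈F′ G≈G′ s) n = begin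
    fromℕ (n !) * G′ n   ≈⟨ *-congˡ (G≈G′ n) ⟨
    fromℕ (n !) * G n    ≈⟨ substitution-coefficients s n ⟩
    sum≤ n (t F)         ≈⟨ sum≤-cong n (t F) (t F′) (λ m _ → *-congˡ (*-congˡ (F≈F′ m))) ⟩
    sum≤ n (t F′)        ∎
    where
    t : Series → ℕ → Carrier
    t F m = degenerateStirling₁ h n m * -1^ m * (fromℕ (m !) * F m)

module DegeneratePolyBernoulliProperties
  {c ℓ₁ ℓ₂} (K : HeytingField c ℓ₁ ℓ₂) (char0 : CharacteristicZero K) where

  open DegeneratePolyBernoulli K char0
  open HeytingCommutativeRing (HeytingField.heytingCommutativeRing K) using (commutativeRing)
  open CommutativeRing commutativeRing hiding (Carrier; _≈_; _+_; _*_; -_; 0#; 1#)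
  open SeriesProperties commutativeRing hiding (fromℕ)
  open RingProperties ring using (-‿distribˡ-*; -0#≈0#)
  open MultProperties semiring using (×-homo-1; ×1-homo-*)
  open ExpProperties commutativeSemiring using (^-distrib-*; ^-congˡ; ^-homo-*)
  open SemiringSolver commutativeSemiring
  open Falling (CommutativeRing.rawRing commutativeRing) using (falling)
  open ≈-Reasoning setoid

  -- Inverses and integer powers in the field

  -- The value `1/ x` depends on the apartness proof carried by `x`; uniqueness of inverses
  -- identifies it without inspecting that proof.
  1/-unique : ∀ x {y} → value x * y ≈ 1# → 1/ x ≈ y
  1/-unique x {y} xy≈1 = begin
    1/ x                    ≈⟨ *-identityʳ _ ⟨
    1/ x * 1#               ≈⟨ *-congˡ xy≈1 ⟨
    1/ x * (value x * y)    ≈⟨ solve 3 (λ x y z → x :* (y :* z) := y :* x :* z) refl (1/ x) (value x) y ⟩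
    value x * 1/ x * y      ≈⟨ *-congʳ (x*1/x≈1 x) ⟩
    1# * y                  ≈⟨ *-identityˡ _ ⟩
    y                       ∎

  1^n≈1 : ∀ n → 1# ^ n ≈ 1#
  1^n≈1 zero    = refl
  1^n≈1 (suc n) = trans (*-identityˡ _) (1^n≈1 n)

  x^n*[1/x]^n≈1 : ∀ x n → value x ^ n * (1/ x) ^ n ≈ 1#
  x^n*[1/x]^n≈1 x n = begin
    value x ^ n * (1/ x) ^ n   ≈⟨ ^-distrib-* (value x) (1/ x) n ⟨
    (value x * 1/ x) ^ n       ≈⟨ ^-congˡ n (x*1/x≈1 x) ⟩
    1# ^ n                     ≈⟨ 1^n≈1 n ⟩
    1#                         ∎

  -- Turns the coefficient 1 / (j + 1)^(-k) of `Li/u` into (j + 1)^k. The cases are those in which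
  -- integer negation computes.
  1/^ᶻ-neg : ∀ x k → 1/ (x ^ᶻ (ℤ.- k)) ≈ value (x ^ᶻ k)
  1/^ᶻ-neg x (ℤ.+ zero)    = 1/-unique (x ^ᶻ (ℤ.+ 0)) (*-identityʳ 1#)
  1/^ᶻ-neg x (ℤ.+ suc n)   = 1/-unique (x ^ᶻ ℤ.-[1+ n ])
    (trans (*-comm _ _) (x^n*[1/x]^n≈1 x (suc n)))
  1/^ᶻ-neg x (ℤ.-[1+ n ])  = 1/-unique (x ^ᶻ (ℤ.+ suc n)) (x^n*[1/x]^n≈1 x (suc n))

  1/factorial-suc : ∀ n → fromℕ (suc n) * 1/ factorial (suc n) ≈ 1/ factorial n
  1/factorial-suc n = sym (1/-unique (factorial n) (begin
    fromℕ (n !) * (fromℕ (suc n) * 1/ factorial (suc n))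
      ≈⟨ solve 3 (λ x y z → x :* (y :* z) := y :* x :* z) refl _ _ _ ⟩
    fromℕ (suc n) * fromℕ (n !) * 1/ factorial (suc n)
      ≈⟨ *-congʳ (×1-homo-* (suc n) (n !)) ⟨
    fromℕ (suc n !) * 1/ factorial (suc n)
      ≈⟨ x*1/x≈1 (factorial (suc n)) ⟩
    1# ∎))

  -- The exponential and binomial series as solutions of the recurrences

  egf-binomial : ∀ {h b} a → a 0 ≈ 1# →
    (∀ n → a (suc n) ≈ (b + - (fromℕ n * h)) * a n) → IsBinomialSeries h b (egf a)
  egf-binomial {h} {b} a a₀≈1 recurrence = record
    { head = trans (*-congʳ (trans a₀≈1 (sym (×-homo-1 1#)))) (x*1/x≈1 (factorial 0))
    ; step = λ n → begin
        fromℕ (suc n) * (a (suc n) * 1/ factorial (suc n))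
          ≈⟨ solve 3 (λ x y z → x :* (y :* z) := y :* (x :* z)) refl _ _ _ ⟩
        a (suc n) * (fromℕ (suc n) * 1/ factorial (suc n))
          ≈⟨ *-cong (recurrence n) (1/factorial-suc n) ⟩
        (b + - (fromℕ n * h)) * a n * 1/ factorial n
          ≈⟨ *-assoc _ _ _ ⟩
        (b + - (fromℕ n * h)) * egf a n ∎
    }

  exp-binomial : IsBinomialSeries 0# 1# exp
  exp-binomial = egf-binomial (λ _ → 1#) refl (λ n → sym (begin
    (1# + - (fromℕ n * 0#)) * 1#   ≈⟨ *-identityʳ _ ⟩
    1# + - (fromℕ n * 0#)          ≈⟨ +-congˡ (trans (-‿cong (zeroʳ _)) -0#≈0#) ⟩
    1# + 0#                        ≈⟨ +-identityʳ 1# ⟩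
    1#                             ∎))

  -- In the normalisation (1 + h t)^(a/h) the exponent -1/ƛ corresponds to a = (-1/ƛ) ƛ = -1.
  binomialSeries-binomial : ∀ ƛ → IsBinomialSeries (value ƛ) (- 1#) (binomialSeries (value ƛ) (- (1/ ƛ)))
  binomialSeries-binomial ƛ = egf-binomial _ (*-identityʳ 1#) (λ n → begin
    falling a n * (a + - fromℕ n) * (h * h ^ n)
      ≈⟨ solve 5 (λ f a m h p → f :* (a :+ m) :* (h :* p) := (a :* h :+ m :* h) :* (f :* p)) refl
           (falling a n) a (- fromℕ n) h (h ^ n) ⟩
    (a * h + - fromℕ n * h) * (falling a n * h ^ n)
      ≈⟨ *-congʳ (+-cong a*h≈-1 (sym (-‿distribˡ-* _ _))) ⟩
    (- 1# + - (fromℕ n * h)) * (falling a n * h ^ n) ∎)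
    where
    a = - (1/ ƛ)
    h = value ƛ
    a*h≈-1 : a * h ≈ - 1#
    a*h≈-1 = trans (sym (-‿distribˡ-* _ _)) (-‿cong (trans (*-comm _ _) (x*1/x≈1 ƛ)))

  -- Stirling numbers of the second kind

  exp-1^ : ℕ → Series
  exp-1^ j = (exp S.+ S.- S.1#) S.^ j

  -- The source of the j! in the final formula: it cancels the 1/j! inside `S₂`.
  factorial*S₂ : ∀ m j → fromℕ (j !) * S₂ m j ≈ fromℕ (m !) * exp-1^ j m
  factorial*S₂ m j = begin
    fromℕ (j !) * (fromℕ (m !) * (exp-1^ j m * 1/ factorial j))
      ≈⟨ solve 4 (λ x y z w → x :* (y :* (z :* w)) := x :* w :* (y :* z)) refl _ _ _ _ ⟩
    fromℕ (j !) * 1/ factorial j * (fromℕ (m !) * exp-1^ j m)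
      ≈⟨ *-congʳ (x*1/x≈1 (factorial j)) ⟩
    1# * (fromℕ (m !) * exp-1^ j m)
      ≈⟨ *-identityˡ _ ⟩
    fromℕ (m !) * exp-1^ j m ∎

  -- The series eᵗ - 1 has no constant term, so its j-th power starts at t^j.
  S₂-vanishes : ∀ {m j} → m < j → S₂ m j ≈ 0#
  S₂-vanishes {m} {j} m<j = begin
    fromℕ (m !) * (exp-1^ j m * 1/ factorial j)
      ≈⟨ *-congˡ (*-congʳ (^-vanishes-below _ exp-1-0 j m<j)) ⟩
    fromℕ (m !) * (0# * 1/ factorial j)
      ≈⟨ trans (*-congˡ (zeroˡ _)) (zeroʳ _) ⟩
    0# ∎
    where
    exp-1-0 : exp 0 + - 1# ≈ 0#
    exp-1-0 = trans (+-congʳ (IsBinomialSeries.head exp-binomial)) (-‿inverseʳ 1#)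

  -- Expansion of the degenerate poly-Bernoulli numbers

  module _ (k : ℤ) (n : ℕ) (ƛ : Nonzero) where

    weight : ℕ → Carrier
    weight j = value (nonzero (suc j) ^ᶻ k)

    summand : ℕ → ℕ → Carrier
    summand m j = (- 1#) ^ (j ℕ.+ m) * fromℕ (j !) * value ƛ ^ (n ∸ m)
      * weight j * S₂ m j * S₁ n m

    private
      u^ : ℕ → Series
      u^ j = argument ƛ S.^ j

      d : ℕ → Carrier
      d = degenerateStirling₁ (value ƛ) n

      t : ℕ → ℕ → Carrier
      t j m = d m * -1^ m * (fromℕ (m !) * (-1^ j * exp-1^ j m))

    argument-power-coefficients : ∀ j → weight j * (fromℕ (n !) * u^ j n) ≈
      ∑[ m ≤ n ] summand m j
    argument-power-coefficients j = begin
      weight j * (fromℕ (n !) * u^ j n)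
        ≈⟨ *-congˡ (substitution-coefficients
             (substitution-^ exp-binomial (binomialSeries-binomial ƛ) j) n) ⟩
      weight j * sum≤ n (t j)
        ≈⟨ *-sum≤ n (weight j) (t j) ⟩
      ∑[ m ≤ n ] (weight j * t j m)
        ≈⟨ sum≤-cong n (λ m → weight j * t j m) (λ m → summand m j) (λ m _ → begin
             weight j * (S₁ n m * value ƛ ^ (n ∸ m) * -1^ m * (fromℕ (m !) * (-1^ j * exp-1^ j m)))
               ≈⟨ solve 7 (λ w s l x f y e →
                    w :* (s :* l :* x :* (f :* (y :* e))) := y :* x :* (w :* s :* l) :* (f :* e)) refl
                    (weight j) (S₁ n m) (value ƛ ^ (n ∸ m)) (-1^ m) (fromℕ (m !)) (-1^ j) (exp-1^ j m) ⟩
             -1^ j * -1^ m * (weight j * S₁ n m * value ƛ ^ (n ∸ m)) * (fromℕ (m !) * exp-1^ j m)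
               -- The sign (-1)^j comes from the power of 1 - eᵗ, the sign (-1)^m from the matrix of
               -- the substitution.
               ≈⟨ *-cong (*-congʳ (^-homo-* (- 1#) j m)) (factorial*S₂ m j) ⟨
             -1^ (j ℕ.+ m) * (weight j * S₁ n m * value ƛ ^ (n ∸ m)) * (fromℕ (j !) * S₂ m j)
               ≈⟨ solve 6 (λ p w s l f q →
                    p :* (w :* s :* l) :* (f :* q) := p :* f :* l :* w :* q :* s) refl
                    (-1^ (j ℕ.+ m)) (weight j) (S₁ n m) (value ƛ ^ (n ∸ m)) (fromℕ (j !)) (S₂ m j) ⟩
             summand m j ∎) ⟩
      ∑[ m ≤ n ] summand m j ∎

    summand-vanishes : ∀ {m j} → m < j → summand m j ≈ 0#
    summand-vanishes m<j =
      trans (*-congʳ (trans (*-congˡ (S₂-vanishes m<j)) (zeroʳ _))) (zeroˡ _)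

    -- `compose` cuts the outer series at j ≤ n, so j and m range over a square and the sums can be
    -- exchanged.
    β-expansion : β n ƛ (ℤ.- k) ≈ ∑[ m ≤ n ] ∑[ j ≤ m ] summand m j
    β-expansion = begin
      fromℕ (n !) * sum≤ n (λ j → Li/u (ℤ.- k) j * u^ j n)
        ≈⟨ *-sum≤ n (fromℕ (n !)) (λ j → Li/u (ℤ.- k) j * u^ j n) ⟩
      ∑[ j ≤ n ] (fromℕ (n !) * (Li/u (ℤ.- k) j * u^ j n))
        ≈⟨ sum≤-cong n (λ j → fromℕ (n !) * (Li/u (ℤ.- k) j * u^ j n))
             (λ j → ∑[ m ≤ n ] summand m j) (λ j _ → begin
             fromℕ (n !) * (Li/u (ℤ.- k) j * u^ j n)
               ≈⟨ solve 3 (λ x y z → x :* (y :* z) := y :* (x :* z)) refl _ _ _ ⟩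
             Li/u (ℤ.- k) j * (fromℕ (n !) * u^ j n)
               ≈⟨ *-congʳ (1/^ᶻ-neg (nonzero (suc j)) k) ⟩
             weight j * (fromℕ (n !) * u^ j n)
               ≈⟨ argument-power-coefficients j ⟩
             ∑[ m ≤ n ] summand m j ∎) ⟩
      ∑[ j ≤ n ] ∑[ m ≤ n ] summand m j
        ≈⟨ sum≤-comm n n (λ j m → summand m j) ⟩
      ∑[ m ≤ n ] ∑[ j ≤ n ] summand m j
        -- The terms with j > m vanish together with `S₂ m j`, which reduces the square to the
        -- triangle j ≤ m.
        ≈⟨ sum≤-cong n (λ m → ∑[ j ≤ m ] summand m j) (λ m → ∑[ j ≤ n ] summand m j)
             (λ m m≤n → sum≤-extend (summand m) m≤n (λ _ → summand-vanishes)) ⟨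
      ∑[ m ≤ n ] ∑[ j ≤ m ] summand m j ∎

theorem6 : ∀ {c ℓ₁ ℓ₂} (K : HeytingField c ℓ₁ ℓ₂) (char0 : CharacteristicZero K) →
    let open DegeneratePolyBernoulli K char0 in
    (k : ℤ) (n : ℕ) (ƛ : Nonzero) →
    β n ƛ (ℤ.- k) ≈
    ∑[ m ≤ n ] ∑[ j ≤ m ]
    ((- 1#) ^ (j ℕ.+ m) * fromℕ (j !) * value ƛ ^ (n ∸ m)
    * value (nonzero (suc j) ^ᶻ k) * S₂ m j * S₁ n m)
theorem6 K char0 = DegeneratePolyBernoulliProperties.β-expansion K char0
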